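{- (i) If $d \geq 1$ is an odd integer that is not a perfect square, then $2^k d \in \mathcal{P}(-1,1)$ for all but finitely many integers $k \geq 1$. (ii) Conversely, if $2^k d \in \mathcal{P}(-1,1)$ for some integers $k \geq 0$ and $d \geq 1$, then $d$ is not a perfect square.
   Context: Let $\mathcal{S} \subset \mathbb{Z}$. An integer $n > 1$ with positive divisors $1 = d_0 < d_1 < \cdots < d_r < d_{r+1} = n$ is called $\mathcal{S}$-perfect (of the first kind) if there exist $\lambda_1, \ldots, \lambda_r \in \mathcal{S}$ (not necessarily distinct) such that $1+\sum_{j=1}^{r}\lambda_j d_j = n$. (The divisor $1$ always has coefficient $1$, and every divisor $d$ with $1<d<n$ must receive a coefficient from $\mathcal{S}$.) $\mathcal{P}(-1,1)$ denotes the set of all $\{ -1,1\}$-perfect numbers. -}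

module Defs where

open import Level using (0ℓ)
open import Data.Nat.Base as ℕ using (ℕ; _<_)
open import Data.Nat.Properties using (_<?_)
open import Data.Nat.Divisibility using (_∣?_)
open import Data.Fin.Base using (Fin)
open import Data.Integer.Base using (ℤ; +_; 1ℤ; -1ℤ; _+_; _*_)
open import Data.Integer.Properties using (+-0-monoid)
open import Data.List.Base using (List; filter; length; lookup; upTo)
open import Data.List.Membership.Propositional using (_∉_)
open import Data.Product.Base using (∃-syntax; Σ-syntax; _×_)
open import Relation.Binary.PropositionalEquality.Core using (_≡_)
open import Relation.Nullary.Decidable.Core using (_×-dec_)
open import Relation.Unary using (Pred; _∈_; ｛_｝; _∪_)
open import Algebra.Properties.Monoid.Sum +-0-monoid using (sum-syntax)

-- For n > 1 this is d₁ < ⋯ < dᵣ, all divisors except d₀ = 1 and dᵣ₊₁ = n: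
-- upTo n runs over 0, …, n ∸ 1, in increasing order.
innerDivisors : ℕ → List ℕ
innerDivisors n = filter (λ d → (1 <? d) ×-dec (d ∣? n)) (upTo n)

Perfect : Pred ℤ 0ℓ → Pred ℕ 0ℓ
Perfect S n =
  1 < n ×
  Σ[ c ∈ (Fin r → ℤ) ] (∀ j → c j ∈ S) × 1ℤ + (∑[ j < r ] (c j * + lookup ds j)) ≡ + n
  where
  ds : List ℕ
  ds = innerDivisors n

  r : ℕ
  r = length ds

𝒫⟨-1,1⟩ : Pred ℕ 0ℓ
𝒫⟨-1,1⟩ = Perfect (｛ -1ℤ ｝ ∪ ｛ 1ℤ ｝)

IsSquare : Pred ℕ 0ℓ
IsSquare d = ∃[ m ] d ≡ m ℕ.* m

AllButFinitelyMany : Pred ℕ 0ℓ → Set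
AllButFinitelyMany P = Σ[ exceptions ∈ List ℕ ] (∀ k → k ∉ exceptions → P k)

{-# OPTIONS --safe #-}
module Submission where

-- A choice of signs exhibiting n splits the divisors of n into two parts of equal sum, so σ(n)
-- is even; but σ(2^k m²) is odd, as pairing e with n / e shows for odd n, and in general because
-- σ(n) has the parity of σ of the odd part of n. Conversely let d > 1 be odd and not a square.
-- The signed sums of 1, 2, …, 2^(k-1) are all odd numbers of absolute value below 2^k. For each
-- divisor 1 < e < d of d, let e, 2 e, …, 2^k e have signed sum e; the total M of these sums is
-- even because d is not a square. It remains to solve 1 + 2 a + M = d u, where 2, 4, …, 2^k have
-- signed sum 2 a and d, 2 d, …, 2^(k-1) d have signed sum d (2^k - u), with a and u odd. Exactly
-- one of u = 1, 3 makes a odd, and then |a| < 2^k for all large k.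

open import Defs
open import Data.Nat.Base using (ℕ; _*_; _^_; _≤_)
open import Data.Nat.Divisibility using (_∤_)
open import Data.Product.Base using (_×_)
open import Relation.Nullary.Negation.Core using (¬_)
open import Relation.Unary using (_∈_; ｛_｝; _∪_)

open import Data.Empty using (⊥-elim)
open import Data.Fin.Base using (Fin; zero; suc)
open import Data.Integer.Base as ℤ using (ℤ; 1ℤ; -1ℤ)
import Data.Integer.Properties as ℤ
import Data.Integer.Tactic.RingSolver as ℤ
open import Data.List.Base using (List; []; _∷_; _++_; map; length; lookup; filter; upTo)
open import Data.List.Membership.Propositional using () renaming (_∈_ to _∈ˡ_; _∉_ to _∉ˡ_)
open import Data.List.Membership.Propositional.Properties
  using (∈-filter⁺; ∈-filter⁻; ∈-upTo⁺; ∈-upTo⁻; ∈-map⁺; ∈-map⁻; ∈-++⁺ˡ; ∈-++⁺ʳ; ∈-++⁻)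
open import Data.List.Membership.Propositional.Properties.WithK using (unique∧set⇒bag)
open import Data.List.Properties using (length-++; length-map)
open import Data.List.Relation.Binary.BagAndSetEquality using (∼bag⇒↭)
open import Data.List.Relation.Binary.Permutation.Propositional
  using (_↭_; ↭-refl; ↭-sym; ↭-trans; ↭-prep; ↭-swap;
         module PermutationReasoning)
import Data.List.Relation.Binary.Permutation.Propositional.Properties as ↭
open import Data.List.Relation.Unary.All as All using (All; []; _∷_)
open import Data.List.Relation.Unary.AllPairs using ([]; _∷_)
open import Data.List.Relation.Unary.Any using (here; there)
open import Data.List.Relation.Unary.Unique.Propositional using (Unique)
import Data.List.Relation.Unary.Unique.Propositional.Properties as Unique
open import Data.Nat.Base
  using (zero; suc; _+_; _<_; z≤n; s≤s; parity; NonZero; >-nonZero; ≢-nonZero; ≢-nonZero⁻¹)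
open import Data.Nat.Divisibility
  using (_∣_; _∣?_; divides; 1∣_; ∣-refl; ∣-trans; ∣⇒≤; *-monoʳ-∣; *-cancelˡ-∣; n∣m*n; m∣m*n; 0∣⇒≡0)
open import Data.Nat.DivMod using (_/_; m*[n/m]≡n)
open import Data.Nat.Induction using (<-rec)
open import Data.Nat.ListAction using (sum)
open import Data.Nat.ListAction.Properties using (sum-++; sum-↭)
open import Data.Nat.Properties
open import Data.Nat.Tactic.RingSolver using (solve-∀)
open import Data.Parity.Base as ℙ using (0ℙ; 1ℙ)
import Data.Parity.Properties as ℙ
open import Data.Product.Base using (_,_; ∃-syntax; Σ-syntax; proj₁; proj₂)
open import Data.Sum.Base using (_⊎_; inj₁; inj₂; [_,_]′)
open import Function.Base using (_∘_)
open import Function.Bundles using (mk⇔)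
open import Relation.Binary.Definitions using (tri<; tri≈; tri>)
open import Relation.Binary.PropositionalEquality
open import Relation.Nullary.Decidable.Core using (yes; no; _×-dec_)
open import Relation.Nullary.Negation.Core using (contradiction)
open import Algebra.Properties.Monoid.Sum ℤ.+-0-monoid using (sum-syntax)

-- Parity, and permutations of duplicate-free lists

even⊎odd : ∀ n → (∃[ h ] n ≡ 2 * h) ⊎ (∃[ h ] n ≡ 1 + 2 * h)
even⊎odd zero = inj₁ (0 , refl)
even⊎odd (suc n) with even⊎odd n
... | inj₁ (h , refl) = inj₂ (h , refl)
... | inj₂ (h , refl) = inj₁ (suc h , sym (*-suc 2 h))

parity-2* : ∀ n → parity (2 * n) ≡ 0ℙ
parity-2* n = ℙ.*-homo-* 2 n

parity-1+2* : ∀ n → parity (1 + 2 * n) ≡ 1ℙ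
parity-1+2* n = trans (ℙ.+-homo-+ 1 (2 * n)) (cong (1ℙ ℙ.+_) (parity-2* n))

even-half : ∀ n → parity n ≡ 0ℙ → ∃[ h ] n ≡ 2 * h
even-half n e with even⊎odd n
... | inj₁ p = p
... | inj₂ (h , refl) = contradiction (trans (sym e) (parity-1+2* h)) λ ()

odd-half : ∀ n → parity n ≡ 1ℙ → ∃[ h ] n ≡ 1 + 2 * h
odd-half n o with even⊎odd n
... | inj₁ (h , refl) = contradiction (trans (sym o) (parity-2* h)) λ ()
... | inj₂ p = p

2∤⇒odd : ∀ {n} → 2 ∤ n → parity n ≡ 1ℙ
2∤⇒odd {n} 2∤n with even⊎odd n
... | inj₁ (h , refl) = contradiction (m∣m*n h) 2∤n
... | inj₂ (h , refl) = parity-1+2* h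

∣-odd : ∀ {m n} → m ∣ n → parity n ≡ 1ℙ → parity m ≡ 1ℙ
∣-odd {m} (divides q refl) o = ℙ-*-odd (parity q) (parity m) (trans (sym (ℙ.*-homo-* q m)) o)
  where
  ℙ-*-odd : ∀ p q → p ℙ.* q ≡ 1ℙ → q ≡ 1ℙ
  ℙ-*-odd 1ℙ _ e = e

-- In `2 * n ≡ q * m` with `m` odd, parity forces `q` to be even, and half of `q` is the quotient of
-- `n` by `m`.
odd∣2*⇒∣ : ∀ {m n} → parity m ≡ 1ℙ → m ∣ 2 * n → m ∣ n
odd∣2*⇒∣ {m} {n} o (divides q e) with even-half q (parity-q (parity q) refl)
  where
  parity-q : ∀ p → parity q ≡ p → p ≡ 0ℙ
  parity-q 0ℙ _ = refl
  parity-q 1ℙ e′ = contradiction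
    (trans (sym (parity-2* n)) (trans (cong parity e) (trans (ℙ.*-homo-* q m) (cong₂ ℙ._*_ e′ o)))) λ ()
... | h , refl = divides h (*-cancelˡ-≡ n (h * m) 2 (trans e (*-assoc 2 h m)))

odd∣2^*⇒∣ : ∀ {m n} k → parity m ≡ 1ℙ → m ∣ 2 ^ k * n → m ∣ n
odd∣2^*⇒∣ {m} {n} zero o m∣ = subst (m ∣_) (*-identityˡ n) m∣
odd∣2^*⇒∣ {m} {n} (suc k) o m∣ =
  odd∣2^*⇒∣ k o (odd∣2*⇒∣ o (subst (m ∣_) (*-assoc 2 (2 ^ k) n) m∣))

parity-sum-odds : ∀ {xs} → All (λ x → parity x ≡ 1ℙ) xs → parity (sum xs) ≡ parity (length xs)
parity-sum-odds [] = refl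
parity-sum-odds {x ∷ xs} (o ∷ os) = begin
  parity (x + sum xs)            ≡⟨ ℙ.+-homo-+ x (sum xs) ⟩
  parity x ℙ.+ parity (sum xs)   ≡⟨ cong₂ ℙ._+_ o (parity-sum-odds os) ⟩
  1ℙ ℙ.+ parity (length xs)      ≡⟨ ℙ.+-homo-+ 1 (length xs) ⟨
  parity (length (x ∷ xs))       ∎
  where open ≡-Reasoning

sum-map-2* : ∀ xs → sum (map (2 *_) xs) ≡ 2 * sum xs
sum-map-2* [] = refl
sum-map-2* (x ∷ xs) = trans (cong (2 * x +_) (sum-map-2* xs)) (sym (*-distribˡ-+ 2 x (sum xs)))

-- Reduces each decomposition of a divisor list to a comparison of members: without duplicates,
-- equal sets are equal bags, so lengths and sums carry over.
unique∧set⇒↭ : ∀ {xs ys : List ℕ} → Unique xs → Unique ys →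
               (∀ {x} → x ∈ˡ xs → x ∈ˡ ys) → (∀ {x} → x ∈ˡ ys → x ∈ˡ xs) → xs ↭ ys
unique∧set⇒↭ xs! ys! f g = ∼bag⇒↭ (unique∧set⇒bag xs! ys! (mk⇔ f g))

-- Injectivity is asked for on the members of `xs` only: for nonzero `n`, `cofactor n` is injective
-- on the divisors of `n` but not on all of ℕ.
map-unique : ∀ {f : ℕ → ℕ} {xs} → (∀ {x y} → x ∈ˡ xs → y ∈ˡ xs → f x ≡ f y → x ≡ y) →
             Unique xs → Unique (map f xs)
map-unique {xs = []} inj [] = []
map-unique {f} {x ∷ xs} inj (x∉ ∷ xs!) =
  All.tabulate (λ y∈ → λ { refl → fresh y∈ }) ∷ map-unique (λ p q → inj (there p) (there q)) xs!
  where
  fresh : f x ∉ˡ map f xs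
  fresh fx∈ with ∈-map⁻ f fx∈
  ... | y , y∈ , e = All.lookup x∉ y∈ (inj (here refl) (there y∈) e)

-- Lists of divisors, and the parity of σ(2^k d)

divisors : ℕ → List ℕ
divisors n = filter (_∣? n) (upTo (suc n))

divisors-unique : ∀ n → Unique (divisors n)
divisors-unique n = Unique.filter⁺ (_∣? n) (Unique.upTo⁺ (suc n))

∈-divisors⁺ : ∀ {m n} .{{_ : NonZero n}} → m ∣ n → m ∈ˡ divisors n
∈-divisors⁺ {m} {n} m∣n = ∈-filter⁺ (_∣? n) (∈-upTo⁺ (s≤s (∣⇒≤ m∣n))) m∣n

∈-divisors⁻ : ∀ {m} n → m ∈ˡ divisors n → m ∣ n
∈-divisors⁻ n m∈ = proj₂ (∈-filter⁻ (_∣? n) {xs = upTo (suc n)} m∈)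

∈-inner⁻ : ∀ {m} n → m ∈ˡ innerDivisors n → m < n × 1 < m × m ∣ n
∈-inner⁻ n m∈ with ∈-filter⁻ (λ d → (1 <? d) ×-dec (d ∣? n)) {xs = upTo n} m∈
... | m∈upTo , 1<m , m∣n = ∈-upTo⁻ m∈upTo , 1<m , m∣n

-- Ties σ(n) to the divisors that carry a sign; `1 < n` keeps the entries 1 and `n` distinct.
divisors↭inner : ∀ {n} → 1 < n → divisors n ↭ 1 ∷ n ∷ innerDivisors n
divisors↭inner {n} 1<n = unique∧set⇒↭ (divisors-unique n) unique to from
  where
  instance
    _ : NonZero n
    _ = >-nonZero (<-trans (s≤s z≤n) 1<n)
  unique : Unique (1 ∷ n ∷ innerDivisors n)
  unique =
    (<⇒≢ 1<n ∷ All.tabulate (λ m∈ → <⇒≢ (proj₁ (proj₂ (∈-inner⁻ n m∈)))))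
    ∷ All.tabulate (λ m∈ → ≢-sym (<⇒≢ (proj₁ (∈-inner⁻ n m∈))))
    ∷ Unique.filter⁺ (λ d → (1 <? d) ×-dec (d ∣? n)) (Unique.upTo⁺ n)
  to : ∀ {m} → m ∈ˡ divisors n → m ∈ˡ 1 ∷ n ∷ innerDivisors n
  to {m} m∈ with ∈-divisors⁻ n m∈
  ... | m∣n with m ≟ 1 | m ≟ n
  ... | yes refl | _ = here refl
  ... | no _ | yes refl = there (here refl)
  ... | no m≢1 | no m≢n = there (there
    (∈-filter⁺ (λ d → (1 <? d) ×-dec (d ∣? n)) (∈-upTo⁺ (≤∧≢⇒< (∣⇒≤ m∣n) m≢n))
      (≤∧≢⇒< (n≢0⇒n>0 λ { refl → ≢-nonZero⁻¹ n (0∣⇒≡0 m∣n) }) (≢-sym m≢1) , m∣n)))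
  from : ∀ {m} → m ∈ˡ 1 ∷ n ∷ innerDivisors n → m ∈ˡ divisors n
  from (here refl) = ∈-divisors⁺ (1∣ n)
  from (there (here refl)) = ∈-divisors⁺ ∣-refl
  from (there (there m∈)) = ∈-divisors⁺ (proj₂ (proj₂ (∈-inner⁻ n m∈)))

-- An odd divisor of `2 ^ suc k * d` already divides `d`, and an even one is twice a divisor of
-- `2 ^ k * d`.
divisors-2* : ∀ {d} k .{{_ : NonZero d}} → parity d ≡ 1ℙ →
  divisors (2 ^ suc k * d) ↭ divisors d ++ map (2 *_) (divisors (2 ^ k * d))
divisors-2* {d} k o = unique∧set⇒↭ (divisors-unique (2 ^ suc k * d)) unique to from
  where
  n = 2 ^ k * d
  2n≡ : 2 ^ suc k * d ≡ 2 * n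
  2n≡ = *-assoc 2 (2 ^ k) d
  instance
    _ : NonZero (2 ^ k * d)
    _ = m*n≢0 (2 ^ k) d {{m^n≢0 2 k}}
    _ : NonZero (2 ^ suc k * d)
    _ = m*n≢0 (2 ^ suc k) d {{m^n≢0 2 (suc k)}}
  unique : Unique (divisors d ++ map (2 *_) (divisors n))
  unique = Unique.++⁺ (divisors-unique d) (Unique.map⁺ (*-cancelˡ-≡ _ _ 2) (divisors-unique n)) disjoint
    where
    disjoint : ∀ {m} → ¬ (m ∈ˡ divisors d × m ∈ˡ map (2 *_) (divisors n))
    disjoint (m∈ , m∈′) with ∈-map⁻ (2 *_) m∈′
    ... | h , _ , refl =
      contradiction (trans (sym (∣-odd (∈-divisors⁻ d m∈) o)) (parity-2* h)) λ ()
  to : ∀ {m} → m ∈ˡ divisors (2 ^ suc k * d) → m ∈ˡ divisors d ++ map (2 *_) (divisors n)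
  to {m} m∈ with ∈-divisors⁻ (2 ^ suc k * d) m∈ | even⊎odd m
  ... | m∣ | inj₁ (h , refl) =
    ∈-++⁺ʳ (divisors d) (∈-map⁺ (2 *_) (∈-divisors⁺ {h} {n} (*-cancelˡ-∣ 2 (subst (2 * h ∣_) 2n≡ m∣))))
  ... | m∣ | inj₂ (h , refl) = ∈-++⁺ˡ (∈-divisors⁺ (odd∣2^*⇒∣ (suc k) (parity-1+2* h) m∣))
  from : ∀ {m} → m ∈ˡ divisors d ++ map (2 *_) (divisors n) → m ∈ˡ divisors (2 ^ suc k * d)
  from m∈ with ∈-++⁻ (divisors d) m∈
  ... | inj₁ m∈d = ∈-divisors⁺ (∣-trans (∈-divisors⁻ d m∈d) (n∣m*n (2 ^ suc k)))
  ... | inj₂ m∈2n with ∈-map⁻ (2 *_) m∈2n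
  ... | h , h∈ , refl =
    ∈-divisors⁺ (subst (2 * h ∣_) (sym 2n≡) (*-monoʳ-∣ 2 (∈-divisors⁻ n h∈)))

-- By `divisors-2*`, σ(2^(k+1) d) = σ(d) + 2 σ(2^k d), and the second term is even.
parity-sum-divisors-2^* : ∀ {d} k .{{_ : NonZero d}} → parity d ≡ 1ℙ →
  parity (sum (divisors (2 ^ k * d))) ≡ parity (sum (divisors d))
parity-sum-divisors-2^* {d} zero o = cong (parity ∘ sum ∘ divisors) (*-identityˡ d)
parity-sum-divisors-2^* {d} (suc k) o = begin
  parity (sum (divisors (2 ^ suc k * d)))
    ≡⟨ cong parity (sum-↭ (divisors-2* k o)) ⟩
  parity (sum (divisors d ++ map (2 *_) ns))
    ≡⟨ cong parity (sum-++ (divisors d) (map (2 *_) ns)) ⟩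
  parity (sum (divisors d) + sum (map (2 *_) ns))
    ≡⟨ ℙ.+-homo-+ (sum (divisors d)) (sum (map (2 *_) ns)) ⟩
  parity (sum (divisors d)) ℙ.+ parity (sum (map (2 *_) ns))
    ≡⟨ cong (λ s → parity (sum (divisors d)) ℙ.+ parity s) (sum-map-2* ns) ⟩
  parity (sum (divisors d)) ℙ.+ parity (2 * sum ns)
    ≡⟨ cong (parity (sum (divisors d)) ℙ.+_) (parity-2* (sum ns)) ⟩
  parity (sum (divisors d)) ℙ.+ 0ℙ
    ≡⟨ ℙ.+-identityʳ (parity (sum (divisors d))) ⟩
  parity (sum (divisors d)) ∎
  where
  open ≡-Reasoning
  ns = divisors (2 ^ k * d)

-- Pairing e with n / e, and the parity of σ(n)

-- The value at 0 is junk.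
cofactor : ℕ → ℕ → ℕ
cofactor n zero = 0
cofactor n m@(suc _) = n / m

*-cofactor : ∀ {m n} → m ∣ n → m * cofactor n m ≡ n
*-cofactor {zero} m∣n = sym (0∣⇒≡0 m∣n)
*-cofactor {suc m} m∣n = m*[n/m]≡n m∣n

module _ (n : ℕ) .{{_ : NonZero n}} where

  -- The pairing of e with n / e exchanges `small` and `large`; its fixed points are `roots`, a list
  -- so that its length counts them.
  roots small large : List ℕ
  roots = filter (λ m → m * m ≟ n) (upTo (suc n))
  small = filter (λ m → m * m <? n) (divisors n)
  large = filter (λ m → n <? m * m) (divisors n)

  private
    ∣⇒nonZero : ∀ {m} → m ∣ n → NonZero m
    ∣⇒nonZero m∣n = ≢-nonZero λ { refl → ≢-nonZero⁻¹ n (0∣⇒≡0 m∣n) }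

    ∈-small⁻ : ∀ {m} → m ∈ˡ small → m ∣ n × m * m < n
    ∈-small⁻ m∈ with ∈-filter⁻ (λ m → m * m <? n) {xs = divisors n} m∈
    ... | m∈d , m*m<n = ∈-divisors⁻ n m∈d , m*m<n

    ∈-large⁻ : ∀ {m} → m ∈ˡ large → m ∣ n × n < m * m
    ∈-large⁻ m∈ with ∈-filter⁻ (λ m → n <? m * m) {xs = divisors n} m∈
    ... | m∈d , n<m*m = ∈-divisors⁻ n m∈d , n<m*m

    ∈-roots⁻ : ∀ {m} → m ∈ˡ roots → m * m ≡ n
    ∈-roots⁻ m∈ = proj₂ (∈-filter⁻ (λ m → m * m ≟ n) {xs = upTo (suc n)} m∈)

    ∈-roots⁺ : ∀ {m} → m * m ≡ n → m ∈ˡ roots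
    ∈-roots⁺ {m} e = ∈-filter⁺ (λ m → m * m ≟ n) (∈-upTo⁺ (s≤s (∣⇒≤ (divides m (sym e))))) e

    small! : Unique small
    small! = Unique.filter⁺ (λ m → m * m <? n) (divisors-unique n)

    large! : Unique large
    large! = Unique.filter⁺ (λ m → n <? m * m) (divisors-unique n)

    roots! : Unique roots
    roots! = Unique.filter⁺ (λ m → m * m ≟ n) (Unique.upTo⁺ (suc n))

    -- Cancelling `a` in `a * a < a * b` gives `a < b`; multiplying by `b` gives `a * b < b * b`.
    cofactor-large : ∀ {a b} → a * b ≡ n → a * a < n → n < b * b
    cofactor-large {a} {b} refl a*a<a*b =
      *-monoˡ-< b {{∣⇒nonZero (n∣m*n a)}} (*-cancelˡ-< a a b a*a<a*b)

    cofactor-small : ∀ {a b} → a * b ≡ n → n < b * b → a * a < n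
    cofactor-small {a} {b} refl a*b<b*b =
      *-monoʳ-< a {{∣⇒nonZero (m∣m*n b)}} (*-cancelʳ-< b a b a*b<b*b)

  large↭cofactors-small : large ↭ map (cofactor n) small
  large↭cofactors-small = unique∧set⇒↭ large! (map-unique injective small!) to from
    where
    injective : ∀ {a b} → a ∈ˡ small → b ∈ˡ small → cofactor n a ≡ cofactor n b → a ≡ b
    injective {a} {b} a∈ b∈ e =
      -- Both `a` and `b` times the common cofactor equal `n`; the cofactor divides `n`, so it is
      -- nonzero and cancels.
      *-cancelʳ-≡ a b (cofactor n a)
        {{∣⇒nonZero (divides a (sym (*-cofactor (proj₁ (∈-small⁻ a∈)))))}}
        (trans (*-cofactor (proj₁ (∈-small⁻ a∈)))
          (trans (sym (*-cofactor (proj₁ (∈-small⁻ b∈)))) (cong (b *_) (sym e))))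
    to : ∀ {b} → b ∈ˡ large → b ∈ˡ map (cofactor n) small
    to {b} b∈ with ∈-large⁻ b∈
    ... | divides a n≡a*b , n<b*b =
      subst (_∈ˡ map (cofactor n) small) cofactor≡b
        (∈-map⁺ (cofactor n) (∈-filter⁺ (λ m → m * m <? n) (∈-divisors⁺ a∣n)
          (cofactor-small {a} {b} (sym n≡a*b) n<b*b)))
      where
      a∣n : a ∣ n
      a∣n = divides b (trans n≡a*b (*-comm a b))
      cofactor≡b : cofactor n a ≡ b
      cofactor≡b = *-cancelˡ-≡ (cofactor n a) b a {{∣⇒nonZero a∣n}} (trans (*-cofactor a∣n) n≡a*b)
    from : ∀ {b} → b ∈ˡ map (cofactor n) small → b ∈ˡ large
    from b∈ with ∈-map⁻ (cofactor n) b∈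
    ... | a , a∈ , refl with ∈-small⁻ a∈
    ... | a∣n , a*a<n =
      ∈-filter⁺ (λ m → n <? m * m) (∈-divisors⁺ (divides a (sym (*-cofactor a∣n))))
        (cofactor-large {a} {cofactor n a} (*-cofactor a∣n) a*a<n)

  divisors↭roots++small++large : divisors n ↭ roots ++ small ++ large
  divisors↭roots++small++large = unique∧set⇒↭ (divisors-unique n)
    (Unique.++⁺ roots! (Unique.++⁺ small! large!
      λ (m∈s , m∈l) → <-asym (proj₂ (∈-small⁻ m∈s)) (proj₂ (∈-large⁻ m∈l)))
      λ (m∈r , m∈sl) → [ (λ m∈s → <⇒≢ (proj₂ (∈-small⁻ m∈s)) (∈-roots⁻ m∈r))
                       , (λ m∈l → >⇒≢ (proj₂ (∈-large⁻ m∈l)) (∈-roots⁻ m∈r)) ]′ (∈-++⁻ small m∈sl))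
    to from
    where
    to : ∀ {m} → m ∈ˡ divisors n → m ∈ˡ roots ++ small ++ large
    to {m} m∈ with <-cmp (m * m) n
    ... | tri< m*m<n _ _ = ∈-++⁺ʳ roots (∈-++⁺ˡ (∈-filter⁺ (λ m → m * m <? n) m∈ m*m<n))
    ... | tri≈ _ m*m≡n _ = ∈-++⁺ˡ (∈-roots⁺ m*m≡n)
    ... | tri> _ _ n<m*m = ∈-++⁺ʳ roots (∈-++⁺ʳ small (∈-filter⁺ (λ m → n <? m * m) m∈ n<m*m))
    from : ∀ {m} → m ∈ˡ roots ++ small ++ large → m ∈ˡ divisors n
    from {m} m∈ with ∈-++⁻ roots m∈
    ... | inj₁ m∈r = ∈-divisors⁺ (divides m (sym (∈-roots⁻ m∈r)))
    ... | inj₂ m∈sl with ∈-++⁻ small m∈sl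
    ... | inj₁ m∈s = ∈-divisors⁺ (proj₁ (∈-small⁻ m∈s))
    ... | inj₂ m∈l = ∈-divisors⁺ (proj₁ (∈-large⁻ m∈l))

  -- All divisors of an odd number are odd, so σ(n) has the parity of their number. The equally long
  -- lists `small` and `large` cancel modulo 2.
  parity-sum-divisors-odd : parity n ≡ 1ℙ → parity (sum (divisors n)) ≡ parity (length roots)
  parity-sum-divisors-odd o = begin
    parity (sum (divisors n))
      ≡⟨ parity-sum-odds (All.tabulate λ m∈ → ∣-odd (∈-divisors⁻ n m∈) o) ⟩
    parity (length (divisors n))
      ≡⟨ cong parity (↭.↭-length divisors↭roots++small++large) ⟩
    parity (length (roots ++ small ++ large))
      ≡⟨ cong parity (trans (length-++ roots) (cong (length roots +_) (length-++ small))) ⟩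
    parity (length roots + (length small + length large))
      ≡⟨ cong (λ l → parity (length roots + (length small + l)))
           (trans (↭.↭-length large↭cofactors-small) (length-map (cofactor n) small)) ⟩
    parity (length roots + (length small + length small))
      ≡⟨ ℙ.+-homo-+ (length roots) (length small + length small) ⟩
    parity (length roots) ℙ.+ parity (length small + length small)
      ≡⟨ cong (parity (length roots) ℙ.+_)
           (trans (ℙ.+-homo-+ (length small) (length small)) (ℙ.p+p≡0ℙ (parity (length small)))) ⟩
    parity (length roots) ℙ.+ 0ℙ
      ≡⟨ ℙ.+-identityʳ (parity (length roots)) ⟩
    parity (length roots) ∎
    where open ≡-Reasoning

  roots-¬square : ¬ IsSquare n → length roots ≡ 0
  roots-¬square ¬sq = ↭.↭-length
    (unique∧set⇒↭ roots! [] (λ {m} m∈ → ⊥-elim (¬sq (m , sym (∈-roots⁻ m∈)))) (λ ()))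

  roots-square : ∀ {r} → n ≡ r * r → length roots ≡ 1
  roots-square {r} n≡r*r = ↭.↭-length
    (unique∧set⇒↭ roots! ([] ∷ [])
      (λ m∈ → here (square-injective {b = r} (trans (∈-roots⁻ m∈) n≡r*r)))
      (λ { (here refl) → ∈-roots⁺ {r} (sym n≡r*r) }))
    where
    square-injective : ∀ {a b} → a * a ≡ b * b → a ≡ b
    square-injective {a} {b} e with <-cmp a b
    ... | tri< a<b _ _ = contradiction e (<⇒≢ (*-mono-< a<b a<b))
    ... | tri≈ _ a≡b _ = a≡b
    ... | tri> _ _ b<a = contradiction e (>⇒≢ (*-mono-< b<a b<a))

-- Strong induction on `m`, for all `k` at once: if m = 2 h, then 2^k m² = 2^(k+2) h². If `m` is
-- odd, the power of 2 does not affect the parity, and m² has exactly one root.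
sum-divisors-2^*square-odd : ∀ m k → 1 ≤ m → parity (sum (divisors (2 ^ k * (m * m)))) ≡ 1ℙ
sum-divisors-2^*square-odd = <-rec _ go
  where
  regroup : ∀ q h → q * (2 * h * (2 * h)) ≡ 2 * (2 * q) * (h * h)
  regroup = solve-∀
  go : ∀ m → (∀ {h} → h < m → ∀ k → 1 ≤ h → parity (sum (divisors (2 ^ k * (h * h)))) ≡ 1ℙ) →
       ∀ k → 1 ≤ m → parity (sum (divisors (2 ^ k * (m * m)))) ≡ 1ℙ
  go m ih k 1≤m with even⊎odd m
  ... | inj₁ (zero , refl) = contradiction 1≤m λ ()
  ... | inj₁ (h@(suc _) , refl) =
    trans (cong (parity ∘ sum ∘ divisors) (regroup (2 ^ k) h)) (ih (m<m+n h (s≤s z≤n)) (2 + k) (s≤s z≤n))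
  ... | inj₂ (h , refl) =
    trans (parity-sum-divisors-2^* {m * m} k odd)
      (trans (parity-sum-divisors-odd (m * m) odd) (cong parity (roots-square (m * m) {m} refl)))
    where
    odd : parity (m * m) ≡ 1ℙ
    odd = trans (ℙ.*-homo-* m m) (cong₂ ℙ._*_ (parity-1+2* h) (parity-1+2* h))

-- Choices of signs as splittings into two parts

-- Splits xs p q: some choice of signs for xs has positive part p and negative part q.
data Splits : List ℕ → ℕ → ℕ → Set where
  []    : Splits [] 0 0
  plus  : ∀ {xs p q} x → Splits xs p q → Splits (x ∷ xs) (x + p) q
  minus : ∀ {xs p q} x → Splits xs p q → Splits (x ∷ xs) p (x + q)

Splits-sum : ∀ {xs p q} → Splits xs p q → p + q ≡ sum xs
Splits-sum [] = refl
Splits-sum (plus {p = p} {q} x s) = trans (+-assoc x p q) (cong (x +_) (Splits-sum s))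
Splits-sum (minus {p = p} {q} x s) =
  trans (trans (sym (+-assoc p x q)) (trans (cong (_+ q) (+-comm p x)) (+-assoc x p q)))
    (cong (x +_) (Splits-sum s))

Splits-cast : ∀ {xs p p′ q q′} → p ≡ p′ → q ≡ q′ → Splits xs p q → Splits xs p′ q′
Splits-cast refl refl s = s

+-swap : ∀ x y z → x + (y + z) ≡ y + (x + z)
+-swap = solve-∀

-- Each entry keeps its sign. Only exchanging two entries of equal sign reassociates an index, which
-- `+-swap` repairs.
Splits-↭ : ∀ {xs ys p q} → xs ↭ ys → Splits xs p q → Splits ys p q
Splits-↭ _↭_.refl s = s
Splits-↭ (_↭_.prep x r) (plus x s) = plus x (Splits-↭ r s)
Splits-↭ (_↭_.prep x r) (minus x s) = minus x (Splits-↭ r s)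
Splits-↭ (_↭_.swap x y r) (plus x (plus {p = p} y s)) =
  Splits-cast (+-swap y x p) refl (plus y (plus x (Splits-↭ r s)))
Splits-↭ (_↭_.swap x y r) (plus x (minus y s)) = minus y (plus x (Splits-↭ r s))
Splits-↭ (_↭_.swap x y r) (minus x (plus y s)) = plus y (minus x (Splits-↭ r s))
Splits-↭ (_↭_.swap x y r) (minus x (minus {q = q} y s)) =
  Splits-cast refl (+-swap y x q) (minus y (minus x (Splits-↭ r s)))
Splits-↭ (_↭_.trans r₁ r₂) s = Splits-↭ r₂ (Splits-↭ r₁ s)

Splits-map-2* : ∀ {xs p q} → Splits xs p q → Splits (map (2 *_) xs) (2 * p) (2 * q)
Splits-map-2* [] = []
Splits-map-2* (plus {p = p} x s) =
  Splits-cast (sym (*-distribˡ-+ 2 x p)) refl (plus (2 * x) (Splits-map-2* s))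
Splits-map-2* (minus {q = q} x s) =
  Splits-cast refl (sym (*-distribˡ-+ 2 x q)) (minus (2 * x) (Splits-map-2* s))

Splits-minus-++ : ∀ xs {ys p q} → Splits ys p q → Splits (xs ++ ys) p (sum xs + q)
Splits-minus-++ [] s = s
Splits-minus-++ (x ∷ xs) {q = q} s =
  Splits-cast refl (sym (+-assoc x (sum xs) q)) (minus x (Splits-minus-++ xs s))

Splits-plus : ∀ xs → Splits xs (sum xs) 0
Splits-plus [] = []
Splits-plus (x ∷ xs) = plus x (Splits-plus xs)

Sign : ℤ → Set
Sign = ｛ -1ℤ ｝ ∪ ｛ 1ℤ ｝

plus-value : ∀ x p q → 1ℤ ℤ.* x ℤ.+ (p ℤ.- q) ≡ x ℤ.+ p ℤ.- q
plus-value = ℤ.solve-∀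

minus-value : ∀ x p q → -1ℤ ℤ.* x ℤ.+ (p ℤ.- q) ≡ p ℤ.- (x ℤ.+ q)
minus-value = ℤ.solve-∀

signedSum : (xs : List ℕ) → (Fin (length xs) → ℤ) → ℤ
signedSum xs c = ∑[ j < length xs ] (c j ℤ.* ℤ.+ lookup xs j)

Splits⇒signs : ∀ {xs p q} → Splits xs p q →
  Σ[ c ∈ (Fin (length xs) → ℤ) ] (∀ j → c j ∈ Sign) ×
    signedSum xs c ≡ ℤ.+ p ℤ.- ℤ.+ q
Splits⇒signs [] = (λ ()) , (λ ()) , refl
Splits⇒signs (plus {p = p} {q} x s) with Splits⇒signs s
... | c , c∈ , e =
  (λ { zero → 1ℤ ; (suc j) → c j }) , (λ { zero → inj₂ refl ; (suc j) → c∈ j }) ,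
  trans (cong (ℤ._+_ (1ℤ ℤ.* ℤ.+ x)) e) (plus-value (ℤ.+ x) (ℤ.+ p) (ℤ.+ q))
Splits⇒signs (minus {p = p} {q} x s) with Splits⇒signs s
... | c , c∈ , e =
  (λ { zero → -1ℤ ; (suc j) → c j }) , (λ { zero → inj₁ refl ; (suc j) → c∈ j }) ,
  trans (cong (ℤ._+_ (-1ℤ ℤ.* ℤ.+ x)) e) (minus-value (ℤ.+ x) (ℤ.+ p) (ℤ.+ q))

signs⇒Splits : ∀ xs (c : Fin (length xs) → ℤ) → (∀ j → c j ∈ Sign) →
  ∃[ p ] ∃[ q ] Splits xs p q × signedSum xs c ≡ ℤ.+ p ℤ.- ℤ.+ q
signs⇒Splits [] c c∈ = 0 , 0 , [] , refl
signs⇒Splits (x ∷ xs) c c∈ with signs⇒Splits xs (c ∘ suc) (c∈ ∘ suc) | c∈ zero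
... | p , q , s , e | inj₂ 1≡c = x + p , q , plus x s ,
  trans (cong₂ (λ a b → a ℤ.* ℤ.+ x ℤ.+ b) (sym 1≡c) e) (plus-value (ℤ.+ x) (ℤ.+ p) (ℤ.+ q))
... | p , q , s , e | inj₁ -1≡c = p , x + q , minus x s ,
  trans (cong₂ (λ a b → a ℤ.* ℤ.+ x ℤ.+ b) (sym -1≡c) e) (minus-value (ℤ.+ x) (ℤ.+ p) (ℤ.+ q))

-- Moving the negative part across the equation 1 + (p - q) = n leaves an equation between natural
-- numbers.
Splits⇒perfect : ∀ {n p q} → 1 < n → Splits (innerDivisors n) p q → 1 + p ≡ n + q → n ∈ 𝒫⟨-1,1⟩
Splits⇒perfect {n} {p} {q} 1<n s e with Splits⇒signs s
... | c , c∈ , v = 1<n , c , c∈ , (begin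
  1ℤ ℤ.+ signedSum (innerDivisors n) c ≡⟨ cong (ℤ._+_ 1ℤ) v ⟩
  1ℤ ℤ.+ (ℤ.+ p ℤ.- ℤ.+ q)       ≡⟨ ℤ.+-assoc 1ℤ (ℤ.+ p) (ℤ.- (ℤ.+ q)) ⟨
  ℤ.+ (1 + p) ℤ.- ℤ.+ q          ≡⟨ cong (λ t → ℤ.+ t ℤ.- ℤ.+ q) e ⟩
  ℤ.+ n ℤ.+ ℤ.+ q ℤ.- ℤ.+ q      ≡⟨ cancel (ℤ.+ n) (ℤ.+ q) ⟩
  ℤ.+ n                          ∎)
  where
  open ≡-Reasoning
  cancel : ∀ a b → a ℤ.+ b ℤ.- b ≡ a
  cancel = ℤ.solve-∀

perfect⇒Splits : ∀ {n} → n ∈ 𝒫⟨-1,1⟩ → ∃[ p ] ∃[ q ] Splits (innerDivisors n) p q × 1 + p ≡ n + q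
perfect⇒Splits {n} (_ , c , c∈ , e) with signs⇒Splits (innerDivisors n) c c∈
... | p , q , s , v = p , q , s , ℤ.+-injective (begin
  ℤ.+ (1 + p)                              ≡⟨ rearrange 1ℤ (ℤ.+ p) (ℤ.+ q) ⟩
  1ℤ ℤ.+ (ℤ.+ p ℤ.- ℤ.+ q) ℤ.+ ℤ.+ q       ≡⟨ cong (λ t → 1ℤ ℤ.+ t ℤ.+ ℤ.+ q) v ⟨
  1ℤ ℤ.+ signedSum (innerDivisors n) c ℤ.+ ℤ.+ q ≡⟨ cong (λ t → t ℤ.+ ℤ.+ q) e ⟩
  ℤ.+ (n + q)                              ∎)
  where
  open ≡-Reasoning
  rearrange : ∀ a b c → a ℤ.+ b ≡ a ℤ.+ (b ℤ.- c) ℤ.+ c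
  rearrange = ℤ.solve-∀

-- σ(n) = 1 + n + (p + q) = (1 + p) + (n + q), and perfection makes the two brackets equal.
perfect⇒sum-divisors-even : ∀ {n} → n ∈ 𝒫⟨-1,1⟩ → parity (sum (divisors n)) ≡ 0ℙ
perfect⇒sum-divisors-even {n} P with perfect⇒Splits P
... | p , q , s , e = begin
  parity (sum (divisors n))             ≡⟨ cong parity (sum-↭ (divisors↭inner (proj₁ P))) ⟩
  parity (1 + (n + sum (innerDivisors n))) ≡⟨ cong (λ t → parity (1 + (n + t))) (Splits-sum s) ⟨
  parity (1 + (n + (p + q)))            ≡⟨ cong (parity ∘ suc) (+-swap n p q) ⟩
  parity (1 + p + (n + q))              ≡⟨ cong (λ t → parity (t + (n + q))) e ⟩
  parity (n + q + (n + q))              ≡⟨ ℙ.+-homo-+ (n + q) (n + q) ⟩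
  parity (n + q) ℙ.+ parity (n + q)     ≡⟨ ℙ.p+p≡0ℙ (parity (n + q)) ⟩
  0ℙ                                    ∎
  where open ≡-Reasoning

-- Choosing signs for the inner divisors of 2^k d

-- The signed sums of 1, 2, …, 2^(k-1), again separated into positive and negative part.
data Binary : ℕ → ℕ → ℕ → Set where
  []    : Binary 0 0 0
  plus  : ∀ {k x x′} → Binary k x x′ → Binary (suc k) (1 + 2 * x) (2 * x′)
  minus : ∀ {k x x′} → Binary k x x′ → Binary (suc k) (2 * x) (1 + 2 * x′)

-- As 1 + 2 + ... + 2^(k-1) = 2^k - 1, the parts have complementary binary digits. For k > 0 their
-- sum is odd, so exactly one of them is odd; it receives the entry 1, and halving both continues
-- the recursion.
binary : ∀ k x x′ → suc (x + x′) ≡ 2 ^ k → Binary k x x′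
binary zero zero zero e = []
binary (suc k) x x′ e with even⊎odd x | even⊎odd x′
... | inj₁ (a , refl) | inj₁ (b , refl) = contradiction
  (trans (sym (parity-2* (2 ^ k)))
    (trans (cong parity (sym e))
      (trans (cong (parity ∘ suc) (sym (*-distribˡ-+ 2 a b))) (parity-1+2* (a + b))))) λ ()
... | inj₂ (a , refl) | inj₁ (b , refl) =
  plus (binary k a b (*-cancelˡ-≡ _ _ 2 (trans (regroup a b) e)))
  where
  regroup : ∀ a b → 2 * suc (a + b) ≡ suc (1 + 2 * a + 2 * b)
  regroup = solve-∀
... | inj₁ (a , refl) | inj₂ (b , refl) =
  minus (binary k a b (*-cancelˡ-≡ _ _ 2 (trans (regroup a b) e)))
  where
  regroup : ∀ a b → 2 * suc (a + b) ≡ suc (2 * a + (1 + 2 * b))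
  regroup = solve-∀
... | inj₂ (a , refl) | inj₂ (b , refl) = contradiction
  (trans (sym (parity-2* (2 ^ k)))
    (trans (cong parity (trans (sym e) (regroup a b))) (parity-1+2* (suc (a + b))))) λ ()
  where
  regroup : ∀ a b → suc (1 + 2 * a + (1 + 2 * b)) ≡ 1 + 2 * suc (a + b)
  regroup = solve-∀

-- The inner divisors of 2^k d, for odd `d` > 1, in an order suited to induction on k: doubling the
-- number doubles its old inner divisors and adds 2, `d` and the inner divisors of `d`.
blocks : ℕ → ℕ → List ℕ
blocks d zero = innerDivisors d
blocks d (suc k) = d ∷ 2 ∷ innerDivisors d ++ map (2 *_) (blocks d k)

divisors↭blocks : ∀ {d} k → 1 < d → parity d ≡ 1ℙ →
                  divisors (2 ^ k * d) ↭ 1 ∷ 2 ^ k * d ∷ blocks d k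
divisors↭blocks {d} zero 1<d o =
  subst (λ n → divisors n ↭ 1 ∷ n ∷ innerDivisors d) (sym (*-identityˡ d)) (divisors↭inner 1<d)
divisors↭blocks {d} (suc k) 1<d o = begin
  divisors (2 ^ suc k * d)                              ↭⟨ divisors-2* k o ⟩
  divisors d ++ map (2 *_) (divisors n)
    ↭⟨ ↭.++⁺ (divisors↭inner 1<d) (↭.map⁺ (2 *_) (divisors↭blocks k 1<d o)) ⟩
  -- The doubled list contributes 2 = 2 * 1 and 2 * n; the latter is the new number itself and must
  -- move to the front, behind 1.
  1 ∷ d ∷ ds ++ (2 ∷ 2 * n ∷ []) ++ bs
    ↭⟨ ↭-prep 1 (↭-prep d (↭.shifts ds (2 ∷ 2 * n ∷ []))) ⟩
  1 ∷ d ∷ 2 ∷ 2 * n ∷ ds ++ bs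
    ↭⟨ ↭-prep 1 (↭-prep d (↭-swap 2 (2 * n) ↭-refl)) ⟩
  1 ∷ d ∷ 2 * n ∷ 2 ∷ ds ++ bs                          ↭⟨ ↭-prep 1 (↭-swap d (2 * n) ↭-refl) ⟩
  1 ∷ 2 * n ∷ blocks d (suc k)
    ≡⟨ cong (λ m → 1 ∷ m ∷ blocks d (suc k)) (*-assoc 2 (2 ^ k) d) ⟨
  1 ∷ 2 ^ suc k * d ∷ blocks d (suc k)                  ∎
  where
  open PermutationReasoning
  n = 2 ^ k * d
  ds = innerDivisors d
  bs = map (2 *_) (blocks d k)
  instance
    _ : NonZero d
    _ = >-nonZero (<-trans (s≤s z≤n) 1<d)

1<2^*d : ∀ {d} k → 1 < d → 1 < 2 ^ k * d
1<2^*d {d} k 1<d = <-≤-trans 1<d (m≤n*m d (2 ^ k) {{m^n≢0 2 k}})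

inner↭blocks : ∀ {d} k → 1 < d → parity d ≡ 1ℙ → innerDivisors (2 ^ k * d) ↭ blocks d k
inner↭blocks k 1<d o = ↭.drop-∷ (↭.drop-∷
  (↭-trans (↭-sym (divisors↭inner (1<2^*d k 1<d))) (divisors↭blocks k 1<d o)))

-- For a divisor 1 < e < d of d, the signs chosen give 2^k e - 2^(k-1) e - … - e = e;
-- w collects what this contributes to both parts.
blocks-splits : ∀ d {k x x′ y y′} → Binary k x x′ → Binary k y y′ →
  ∃[ w ] Splits (blocks d k) (2 * x + d * y + (sum (innerDivisors d) + w)) (2 * x′ + d * y′ + w)
-- At exponent 0 neither 2 nor `d` is an entry, and each inner divisor e takes a plus sign.
blocks-splits d [] [] = 0 , Splits-cast (p≡ d M) (q≡ d) (Splits-plus (innerDivisors d))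
  where
  M = sum (innerDivisors d)
  p≡ : ∀ d M → M ≡ 2 * 0 + d * 0 + (M + 0)
  p≡ = solve-∀
  q≡ : ∀ d → 0 ≡ 2 * 0 + d * 0 + 0
  q≡ = solve-∀
-- Doubling shifts the binary digits of `x` and `y`; the new entries 2 and `d` supply their lowest
-- digits, one clause for each pair of signs.
blocks-splits d (plus {x = x} {x′} bx) (plus {x = y} {y′} by) with blocks-splits d bx by
-- With the new inner divisors of `d` subtracted, the contribution to the positive part is 2 (M + w)
-- = M + (M + 2 w) and that to the negative part is M + 2 w, so M + 2 w is the new common term.
... | w , s = M + 2 * w , Splits-cast (p≡ d M w x y) (q≡ d M w x′ y′)
  (plus d (plus 2 (Splits-minus-++ (innerDivisors d) (Splits-map-2* s))))
  where
  M = sum (innerDivisors d)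
  p≡ : ∀ d M w x y → d + (2 + 2 * (2 * x + d * y + (M + w)))
       ≡ 2 * (1 + 2 * x) + d * (1 + 2 * y) + (M + (M + 2 * w))
  p≡ = solve-∀
  q≡ : ∀ d M w x y → M + 2 * (2 * x + d * y + w) ≡ 2 * (2 * x) + d * (2 * y) + (M + 2 * w)
  q≡ = solve-∀
blocks-splits d (plus {x = x} {x′} bx) (minus {x = y} {y′} by) with blocks-splits d bx by
... | w , s = M + 2 * w , Splits-cast (p≡ d M w x y) (q≡ d M w x′ y′)
  (minus d (plus 2 (Splits-minus-++ (innerDivisors d) (Splits-map-2* s))))
  where
  M = sum (innerDivisors d)
  p≡ : ∀ d M w x y → 2 + 2 * (2 * x + d * y + (M + w))
       ≡ 2 * (1 + 2 * x) + d * (2 * y) + (M + (M + 2 * w))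
  p≡ = solve-∀
  q≡ : ∀ d M w x y → d + (M + 2 * (2 * x + d * y + w)) ≡ 2 * (2 * x) + d * (1 + 2 * y) + (M + 2 * w)
  q≡ = solve-∀
blocks-splits d (minus {x = x} {x′} bx) (plus {x = y} {y′} by) with blocks-splits d bx by
... | w , s = M + 2 * w , Splits-cast (p≡ d M w x y) (q≡ d M w x′ y′)
  (plus d (minus 2 (Splits-minus-++ (innerDivisors d) (Splits-map-2* s))))
  where
  M = sum (innerDivisors d)
  p≡ : ∀ d M w x y → d + 2 * (2 * x + d * y + (M + w))
       ≡ 2 * (2 * x) + d * (1 + 2 * y) + (M + (M + 2 * w))
  p≡ = solve-∀
  q≡ : ∀ d M w x y → 2 + (M + 2 * (2 * x + d * y + w)) ≡ 2 * (1 + 2 * x) + d * (2 * y) + (M + 2 * w)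
  q≡ = solve-∀
blocks-splits d (minus {x = x} {x′} bx) (minus {x = y} {y′} by) with blocks-splits d bx by
... | w , s = M + 2 * w , Splits-cast (p≡ d M w x y) (q≡ d M w x′ y′)
  (minus d (minus 2 (Splits-minus-++ (innerDivisors d) (Splits-map-2* s))))
  where
  M = sum (innerDivisors d)
  p≡ : ∀ d M w x y → 2 * (2 * x + d * y + (M + w))
       ≡ 2 * (2 * x) + d * (2 * y) + (M + (M + 2 * w))
  p≡ = solve-∀
  q≡ : ∀ d M w x y → d + (2 + (M + 2 * (2 * x + d * y + w)))
       ≡ 2 * (1 + 2 * x) + d * (1 + 2 * y) + (M + 2 * w)
  q≡ = solve-∀

-- The term `w` of `blocks-splits` occurs in both parts and cancels, so the equation to be solved
-- does not mention it.
perfect-2^* : ∀ {d} k {x x′ y y′} → 1 < d → parity d ≡ 1ℙ →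
  suc (x + x′) ≡ 2 ^ k → suc (y + y′) ≡ 2 ^ k →
  1 + (2 * x + d * y + sum (innerDivisors d)) ≡ 2 ^ k * d + (2 * x′ + d * y′) →
  2 ^ k * d ∈ 𝒫⟨-1,1⟩
perfect-2^* {d} k {x} {x′} {y} {y′} 1<d o ex ey e
  with blocks-splits d (binary k x x′ ex) (binary k y y′ ey)
... | w , s = Splits⇒perfect (1<2^*d k 1<d) (Splits-↭ (↭-sym (inner↭blocks k 1<d o)) s)
  (begin
    1 + (2 * x + d * y + (M + w))             ≡⟨ cong suc (+-assoc (2 * x + d * y) M w) ⟨
    1 + (2 * x + d * y + M) + w               ≡⟨ cong (_+ w) e ⟩
    2 ^ k * d + (2 * x′ + d * y′) + w         ≡⟨ +-assoc (2 ^ k * d) (2 * x′ + d * y′) w ⟩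
    2 ^ k * d + (2 * x′ + d * y′ + w)         ∎)
  where
  open ≡-Reasoning
  M = sum (innerDivisors d)

-- Solving the equation for large k

n<2^n : ∀ n → n < 2 ^ n
n<2^n zero = s≤s z≤n
n<2^n (suc n) = <-≤-trans (s≤s (n<2^n n)) (+-mono-≤ (m^n>0 2 n) (m≤m+n (2 ^ n) 0))

-- σ(d) = 1 + d + M with 1 and `d` odd, so M has the parity of σ(d), which is even because `d` has
-- no square root.
sum-inner-even : ∀ {d} → 1 < d → parity d ≡ 1ℙ → ¬ IsSquare d → ∃[ m ] sum (innerDivisors d) ≡ 2 * m
sum-inner-even {d} 1<d o ¬sq = even-half M (begin
  parity M                          ≡⟨ ℙ.⁻¹-involutive (parity M) ⟨
  1ℙ ℙ.+ (1ℙ ℙ.+ parity M)          ≡⟨ cong (λ p → 1ℙ ℙ.+ (p ℙ.+ parity M)) o ⟨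
  1ℙ ℙ.+ (parity d ℙ.+ parity M)    ≡⟨ cong (1ℙ ℙ.+_) (ℙ.+-homo-+ d M) ⟨
  1ℙ ℙ.+ parity (d + M)             ≡⟨ ℙ.+-homo-+ 1 (d + M) ⟨
  parity (1 + (d + M))              ≡⟨ cong parity (sum-↭ (divisors↭inner 1<d)) ⟨
  parity (sum (divisors d))         ≡⟨ parity-sum-divisors-odd d o ⟩
  parity (length (roots d))         ≡⟨ cong parity (roots-¬square d ¬sq) ⟩
  0ℙ                                ∎)
  where
  open ≡-Reasoning
  M = sum (innerDivisors d)
  instance
    _ : NonZero d
    _ = >-nonZero (<-trans (s≤s z≤n) 1<d)

-- With x = C + m + r, x′ = 2 m + r and y′ = ε, the equation of perfect-2^* holds. The two possible
-- values of ε give values of C of opposite parity, so one of them makes C + m odd.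
perfect-2^suc : ∀ {d m C h r ε y} k → 1 < d → parity d ≡ 1ℙ → sum (innerDivisors d) ≡ 2 * m →
  1 + 2 * C ≡ d * (1 + 2 * ε) → C + m ≡ 1 + 2 * h →
  y + ε ≡ 1 + 2 * (h + m + r) → suc (h + m) + r ≡ 2 ^ k → 2 ^ suc k * d ∈ 𝒫⟨-1,1⟩
perfect-2^suc {d} {m} {C} {h} {r} {ε} {y} k 1<d o M≡ C≡ C+m≡ y+ε≡ Q≡ =
  perfect-2^* (suc k) {C + m + r} {2 * m + r} {y} {ε} 1<d o x+x′ y+y′ balance
  where
  open ≡-Reasoning
  s = h + m + r
  x+x′ : suc (C + m + r + (2 * m + r)) ≡ 2 ^ suc k
  x+x′ = begin
    suc (C + m + r + (2 * m + r))            ≡⟨ cong (λ t → suc (t + r + (2 * m + r))) C+m≡ ⟩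
    suc (1 + 2 * h + r + (2 * m + r))        ≡⟨ regroup h m r ⟩
    2 * (suc (h + m) + r)                    ≡⟨ cong (2 *_) Q≡ ⟩
    2 ^ suc k                                ∎
    where
    regroup : ∀ h m r → suc (1 + 2 * h + r + (2 * m + r)) ≡ 2 * (suc (h + m) + r)
    regroup = solve-∀
  y+y′ : suc (y + ε) ≡ 2 ^ suc k
  y+y′ = begin
    suc (y + ε)              ≡⟨ cong suc y+ε≡ ⟩
    suc (1 + 2 * s)          ≡⟨ *-suc 2 s ⟨
    2 * (suc (h + m) + r)    ≡⟨ cong (2 *_) Q≡ ⟩
    2 ^ suc k                ∎
  balance : 1 + (2 * (C + m + r) + d * y + sum (innerDivisors d))
    ≡ 2 ^ suc k * d + (2 * (2 * m + r) + d * ε)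
  balance = begin
    1 + (2 * (C + m + r) + d * y + sum (innerDivisors d))
      ≡⟨ cong (λ t → 1 + (2 * (C + m + r) + d * y + t)) M≡ ⟩
    1 + (2 * (C + m + r) + d * y + 2 * m)
      ≡⟨ regroup₁ C m r d y ⟩
    1 + 2 * C + (d * y + 4 * m + 2 * r)
      ≡⟨ cong (_+ (d * y + 4 * m + 2 * r)) C≡ ⟩
    d * (1 + 2 * ε) + (d * y + 4 * m + 2 * r)
      -- Here 1 + 2 ε + y is regrouped as suc (y + ε) + ε, to expose the factor 2^(k+1).
      ≡⟨ regroup₂ m r d y ε ⟩
    d * suc (y + ε) + (2 * (2 * m + r) + d * ε)
      ≡⟨ cong (λ t → d * t + (2 * (2 * m + r) + d * ε)) y+y′ ⟩
    d * 2 ^ suc k + (2 * (2 * m + r) + d * ε)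
      ≡⟨ cong (_+ (2 * (2 * m + r) + d * ε)) (*-comm d (2 ^ suc k)) ⟩
    2 ^ suc k * d + (2 * (2 * m + r) + d * ε) ∎
    where
    regroup₁ : ∀ C m r d y → 1 + (2 * (C + m + r) + d * y + 2 * m) ≡ 1 + 2 * C + (d * y + 4 * m + 2 * r)
    regroup₁ = solve-∀
    regroup₂ : ∀ m r d y ε → d * (1 + 2 * ε) + (d * y + 4 * m + 2 * r)
      ≡ d * suc (y + ε) + (2 * (2 * m + r) + d * ε)
    regroup₂ = solve-∀

-- The slack `r` exists as soon as 2^k exceeds a fixed bound, and k < 2^k lets that bound itself
-- serve as K.
eventually-perfect : ∀ {d} → 1 < d → parity d ≡ 1ℙ → ¬ IsSquare d →
  ∃[ K ] (∀ k → K ≤ k → 2 ^ suc k * d ∈ 𝒫⟨-1,1⟩)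
eventually-perfect {d} 1<d o ¬sq with odd-half d o | sum-inner-even 1<d o ¬sq
... | c , d≡ | m , M≡ with even⊎odd (c + m)
-- Here ε = 0: then 1 + 2 C = d, so C = c, and c + m is already odd.
... | inj₂ (h , c+m≡) = h + m , λ k K≤k →
  let r , Q≡ = m≤n⇒∃[o]m+o≡n (≤-<-trans K≤k (n<2^n k)) in
  perfect-2^suc {C = c} {h} {r} {0} k 1<d o M≡
    (trans (sym d≡) (sym (*-identityʳ d))) c+m≡ (+-identityʳ _) Q≡
-- Here ε = 1: then 1 + 2 C = 3 d = 3 (1 + 2 c), so C = 1 + 3 c, and C + m = 1 + (c + m) + 2 c = 1 +
-- 2 (h + c) is odd.
... | inj₁ (h , c+m≡) = h + c + m , λ k K≤k →
  let r , Q≡ = m≤n⇒∃[o]m+o≡n (≤-<-trans K≤k (n<2^n k)) in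
  perfect-2^suc {C = 1 + 3 * c} {h + c} {r} {1} k 1<d o M≡
    (trans (regroup₁ c) (cong (_* 3) (sym d≡)))
    (trans (regroup₂ c m) (trans (cong (λ t → 1 + (t + 2 * c)) c+m≡) (regroup₃ c h)))
    (+-comm (2 * (h + c + m + r)) 1) Q≡
  where
  regroup₁ : ∀ c → 1 + 2 * (1 + 3 * c) ≡ (1 + 2 * c) * 3
  regroup₁ = solve-∀
  regroup₂ : ∀ c m → 1 + 3 * c + m ≡ 1 + (c + m + 2 * c)
  regroup₂ = solve-∀
  regroup₃ : ∀ c h → 1 + (2 * h + 2 * c) ≡ 1 + 2 * (h + c)
  regroup₃ = solve-∀

theorem15 : (∀ (d : ℕ) → 1 ≤ d → 2 ∤ d → ¬ IsSquare d →
    AllButFinitelyMany (λ k → 1 ≤ k → 2 ^ k * d ∈ 𝒫⟨-1,1⟩))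
    × (∀ (k d : ℕ) → 1 ≤ d → 2 ^ k * d ∈ 𝒫⟨-1,1⟩ → ¬ IsSquare d)
theorem15 = sufficient , necessary
  where
  sufficient : ∀ d → 1 ≤ d → 2 ∤ d → ¬ IsSquare d →
    AllButFinitelyMany (λ k → 1 ≤ k → 2 ^ k * d ∈ 𝒫⟨-1,1⟩)
  sufficient d 1≤d 2∤d ¬sq
    -- The case d = 1 is excluded because 1 is a square.
    with eventually-perfect (≤∧≢⇒< 1≤d λ { refl → ¬sq (1 , refl) }) (2∤⇒odd 2∤d) ¬sq
  -- `perfect` treats the exponents suc k with K ≤ k, so the exceptions are 0, ..., K.
  ... | K , perfect = upTo (suc K) , λ
    { zero k∉ ()
    ; (suc k) k∉ _ → perfect k (≮⇒≥ λ k<K → k∉ (∈-upTo⁺ (s≤s k<K))) }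
  necessary : ∀ k d → 1 ≤ d → 2 ^ k * d ∈ 𝒫⟨-1,1⟩ → ¬ IsSquare d
  necessary k d 1≤d P (m , refl) = contradiction
    (trans (sym (sum-divisors-2^*square-odd m k (n≢0⇒n>0 λ { refl → contradiction 1≤d λ () })))
      (perfect⇒sum-divisors-even P)) λ ()
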